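{- The problem SCDM is linear time solvable for threshold graphs; that is, there is an algorithm which, given a connected non-complete threshold graph $G=(V,E)$ and a positive integer $l$, decides in time $O(|V|+|E|)$ whether $G$ has a secure connected dominating set of size at most $l$.
   Context: All graphs are finite, simple and undirected. A graph $G=(V,E)$ is a threshold graph if there is a real number $t$ and a real number $w(v)$ for every $v\in V$ such that a set $S\subseteq V$ is independent if and only if $\sum_{v\in S}w(v)\le t$. For a connected graph $G=(V,E)$, a set $S\subseteq V$ is a dominating set if every $u\in V\setminus S$ has a neighbor in $S$; it is a connected dominating set (CDS) if it is a dominating set and the induced subgraph $G[S]$ is connected. A CDS $S$ is a secure connected dominating set (SCDS) of $G$ if for each $u\in V\setminus S$ there exists $v\in S$ such that $uv\in E$ and $(S\setminus\{v\})\cup\{u\}$ is a CDS of $G$. -}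

module Defs where

open import Level using (0ℓ)
open import Data.Bool using (Bool; true; false; if_then_else_)
open import Data.Nat as ℕ using (ℕ; zero; suc)
import Data.Nat.Properties as ℕₚ
open import Data.Integer using (+_)
open import Data.Rational as ℚ using (ℚ; 0ℚ; ½)
import Data.Rational.Properties as ℚₚ
open import Data.Rational.Solver using (module +-*-Solver)
open import Data.Fin using (Fin; toℕ)
import Data.Fin.Properties as Finₚ
open import Data.Fin.Subset using (Subset; inside; outside; ⊤; ⁅_⁆; _∈_; _∉_; _∪_; _-_)
open import Data.List using (List; []; _∷_; _++_; [_]; map; concatMap; filter; length; allFin; cartesianProduct; head; drop)
import Data.List.Membership.Propositional as List
open import Data.List.Relation.Unary.Unique.Propositional using (Unique)
open import Data.Maybe using (Maybe; just; nothing)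
open import Data.Product using (Σ; ∃-syntax; _×_; _,_)
open import Data.Sum using (_⊎_; inj₁; inj₂)
open import Data.Vec using ([]; _∷_)
open import Function using (_∘_; _⇔_)
open import Relation.Binary using (Rel; Symmetric; Irreflexive; Decidable)
open import Relation.Binary.PropositionalEquality using (_≡_; _≢_; refl; sym; cong; subst)
open import Relation.Binary.Construct.Closure.ReflexiveTransitive using (Star)
open import Relation.Nullary using (¬_)
open import Relation.Nullary.Decidable using (_×-dec_)

-- Real numbers, as Cauchy sequences of rationals (with a modulus, since ∃ is
-- constructive).  Two sequences denote the same real when each is ≤ᴿ the other.

IsCauchy : (ℕ → ℚ) → Set
IsCauchy x = ∀ ε → 0ℚ ℚ.< ε →
  ∃[ N ] (∀ m n → N ℕ.≤ m → N ℕ.≤ n → ℚ.∣ x m ℚ.- x n ∣ ℚ.< ε)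

record ℝ : Set where
  constructor mkℝ
  field
    seq    : ℕ → ℚ
    cauchy : IsCauchy seq

open ℝ public

infix 4 _≤ᴿ_

_≤ᴿ_ : Rel ℝ 0ℓ
x ≤ᴿ y = ∀ ε → 0ℚ ℚ.< ε → ∃[ N ] (∀ n → N ℕ.≤ n → seq x n ℚ.≤ seq y n ℚ.+ ε)

private
  half-pos : ∀ {ε} → 0ℚ ℚ.< ε → 0ℚ ℚ.< ½ ℚ.* ε
  half-pos {ε} 0<ε = subst (ℚ._< ½ ℚ.* ε) (ℚₚ.*-zeroʳ ½) (ℚₚ.*-monoʳ-<-pos ½ 0<ε)

  half+half : ∀ ε → ½ ℚ.* ε ℚ.+ ½ ℚ.* ε ≡ ε
  half+half = solve 1 (λ ε → con ½ :* ε :+ con ½ :* ε := ε) refl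
    where open +-*-Solver

  regroup : ∀ a b c d → (a ℚ.+ b) ℚ.- (c ℚ.+ d) ≡ (a ℚ.- c) ℚ.+ (b ℚ.- d)
  regroup = solve 4 (λ a b c d → (a :+ b) :- (c :+ d) := (a :- c) :+ (b :- d)) refl
    where open +-*-Solver

  +-cauchy : ∀ x y → IsCauchy x → IsCauchy y → IsCauchy (λ n → x n ℚ.+ y n)
  +-cauchy x y cx cy ε 0<ε with cx (½ ℚ.* ε) (half-pos 0<ε) | cy (½ ℚ.* ε) (half-pos 0<ε)
  ... | M , hx | N , hy = M ℕ.⊔ N , λ m n p q → begin-strict
      ℚ.∣ (x m ℚ.+ y m) ℚ.- (x n ℚ.+ y n) ∣
        ≡⟨ cong ℚ.∣_∣ (regroup (x m) (y m) (x n) (y n)) ⟩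
      ℚ.∣ (x m ℚ.- x n) ℚ.+ (y m ℚ.- y n) ∣
        ≤⟨ ℚₚ.∣p+q∣≤∣p∣+∣q∣ (x m ℚ.- x n) (y m ℚ.- y n) ⟩
      ℚ.∣ x m ℚ.- x n ∣ ℚ.+ ℚ.∣ y m ℚ.- y n ∣
        <⟨ ℚₚ.+-mono-< (hx m n (left p) (left q)) (hy m n (right p) (right q)) ⟩
      ½ ℚ.* ε ℚ.+ ½ ℚ.* ε
        ≡⟨ half+half ε ⟩
      ε ∎
    where
      open ℚₚ.≤-Reasoning
      left : ∀ {k} → M ℕ.⊔ N ℕ.≤ k → M ℕ.≤ k
      left = ℕₚ.≤-trans (ℕₚ.m≤m⊔n M N)
      right : ∀ {k} → M ℕ.⊔ N ℕ.≤ k → N ℕ.≤ k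
      right = ℕₚ.≤-trans (ℕₚ.m≤n⊔m M N)

0ᴿ : ℝ
0ᴿ = mkℝ (λ _ → 0ℚ) (λ ε 0<ε → 0 , λ _ _ _ _ → 0<ε)

infixl 6 _+ᴿ_

_+ᴿ_ : ℝ → ℝ → ℝ
x +ᴿ y = mkℝ (λ n → seq x n ℚ.+ seq y n) (+-cauchy (seq x) (seq y) (cauchy x) (cauchy y))

sumOver : ∀ {n} → Subset n → (Fin n → ℝ) → ℝ
sumOver []            w = 0ᴿ
sumOver (inside  ∷ S) w = w Fin.zero +ᴿ sumOver S (w ∘ Fin.suc)
sumOver (outside ∷ S) w = sumOver S (w ∘ Fin.suc)

record Graph (n : ℕ) : Set₁ where
  infix 4 _~_ _~?_
  field
    _~_      : Rel (Fin n) 0ℓ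
    ~-sym    : Symmetric _~_
    ~-irrefl : Irreflexive _≡_ _~_
    _~?_     : Decidable _~_

module _ {n : ℕ} (G : Graph n) where
  open Graph G

  edges : List (Fin n × Fin n)
  edges = filter (λ (u , v) → (u Finₚ.<? v) ×-dec (u ~? v))
                 (cartesianProduct (allFin n) (allFin n))

  ∣E∣ : ℕ
  ∣E∣ = length edges

  Complete : Set
  Complete = ∀ u v → u ≢ v → u ~ v

  Independent : Subset n → Set
  Independent S = ∀ {u v} → u ∈ S → v ∈ S → ¬ u ~ v

  IsThreshold : Set
  IsThreshold = ∃[ t ] Σ (Fin n → ℝ) λ w → ∀ S → Independent S ⇔ (sumOver S w ≤ᴿ t)

  InducedConnected : Subset n → Set
  InducedConnected S = ∀ {u v} → u ∈ S → v ∈ S →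
    Star (λ x y → x ∈ S × y ∈ S × x ~ y) u v

  Connected : Set
  Connected = InducedConnected ⊤

  IsDominating : Subset n → Set
  IsDominating S = ∀ {u} → u ∉ S → ∃[ v ] (v ∈ S × u ~ v)

  IsCDS : Subset n → Set
  IsCDS S = IsDominating S × InducedConnected S

  IsSCDS : Subset n → Set
  IsSCDS S = IsCDS S ×
    (∀ {u} → u ∉ S → ∃[ v ] (v ∈ S × u ~ v × IsCDS ((S - v) ∪ ⁅ u ⁆)))

  record AdjacencyLists : Set where
    field
      nbrs      : Fin n → List (Fin n)
      unique    : ∀ u → Unique (nbrs u)
      nbrs-spec : ∀ {u v} → v List.∈ nbrs u ⇔ u ~ v

-- The input word: |V|, then l, then the neighbour list of each vertex in turn,
-- vertex i written as i + 1, each list terminated by 0.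

encode : ∀ {n} {G : Graph n} → AdjacencyLists G → ℕ → List ℕ
encode {n} A l = n ∷ l ∷ concatMap (λ u → map (suc ∘ toℕ) (nbrs u) ++ [ 0 ]) (allFin n)
  where open AdjacencyLists A

-- The random access machine of Cook and Reckhow under the uniform cost
-- criterion (each instruction takes one step), over ℕ with truncated
-- subtraction, and with accept/reject in place of printing.

data Instr : Set where
  const : (x c : ℕ)   → Instr   -- X x ← c
  add   : (x y z : ℕ) → Instr   -- X x ← X y + X z
  sub   : (x y z : ℕ) → Instr   -- X x ← X y ∸ X z
  load  : (x y : ℕ)   → Instr   -- X x ← X (X y)
  store : (x y : ℕ)   → Instr   -- X (X x) ← X y
  read  : (x : ℕ)     → Instr   -- X x ← next input symbol, or 0 if there is none
  jpos  : (p x : ℕ)   → Instr   -- go to instruction p if X x > 0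
  accept reject : Instr

Program : Set
Program = List Instr

record Config : Set where
  constructor ⟨_,_,_⟩
  field
    pc    : ℕ
    reg   : ℕ → ℕ
    input : List ℕ

_[_≔_] : (ℕ → ℕ) → ℕ → ℕ → (ℕ → ℕ)
(X [ x ≔ a ]) y = if x ℕ.≡ᵇ y then a else X y

step : Instr → Config → Config ⊎ Bool
step (const x c) ⟨ pc , X , is ⟩     = inj₁ ⟨ suc pc , X [ x ≔ c ] , is ⟩
step (add x y z) ⟨ pc , X , is ⟩     = inj₁ ⟨ suc pc , X [ x ≔ X y ℕ.+ X z ] , is ⟩
step (sub x y z) ⟨ pc , X , is ⟩     = inj₁ ⟨ suc pc , X [ x ≔ X y ℕ.∸ X z ] , is ⟩
step (load x y)  ⟨ pc , X , is ⟩     = inj₁ ⟨ suc pc , X [ x ≔ X (X y) ] , is ⟩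
step (store x y) ⟨ pc , X , is ⟩     = inj₁ ⟨ suc pc , X [ X x ≔ X y ] , is ⟩
step (read x)    ⟨ pc , X , [] ⟩     = inj₁ ⟨ suc pc , X [ x ≔ 0 ] , [] ⟩
step (read x)    ⟨ pc , X , i ∷ is ⟩ = inj₁ ⟨ suc pc , X [ x ≔ i ] , is ⟩
step (jpos p x)  ⟨ pc , X , is ⟩ with X x
... | zero  = inj₁ ⟨ suc pc , X , is ⟩
... | suc _ = inj₁ ⟨ p , X , is ⟩
step accept      _                   = inj₂ true
step reject      _                   = inj₂ false

-- The verdict reached within the given number of steps, if any.  Leaving the
-- program yields no verdict.

run : Program → ℕ → Config → Maybe Bool
run P zero    c = nothing
run P (suc k) c with head (drop (Config.pc c) P)
... | nothing = nothing
... | just i with step i c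
...   | inj₁ c′ = run P k c′
...   | inj₂ b  = just b

_on_Yields_Within_ : Program → List ℕ → Bool → ℕ → Set
P on is Yields b Within k = run P k ⟨ 0 , (λ _ → 0) , is ⟩ ≡ just b

{-# OPTIONS --safe #-}
module Submission where

-- Write m for the number of leaves.  Every SCDS has at least min(n, m + 2) vertices:
-- if u is outside S and there is a leaf, then every CDS contains the centre d adjacent
-- to all vertices, so no swap removes d; hence S contains all leaves, d, and a neighbour
-- of u that is neither.  If there is no leaf, two vertices are needed because G is not
-- complete.  Conversely V is an SCDS, and so are the leaves together with d and a vertex
-- e that is largest in the vicinal preorder among the vertices other than d: every
-- other vertex has a neighbour besides d, hence is adjacent to e and can replace it.
-- So the answer is yes if and only if n ≤ l or m + 2 ≤ l, and m is counted in one pass.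

open import Defs
open import Data.Bool using (true)
open import Data.Bool.Properties using (T-≡)
open import Data.Empty using (⊥-elim)
open import Data.Fin as Fin using (Fin; zero; suc; toℕ)
import Data.Fin.Properties as Finₚ
open import Data.Fin.Subset using (Subset; inside; outside; ⊤; ⊥; ⁅_⁆; _∈_; _∉_; _∪_; _-_; ∣_∣)
open import Data.Fin.Subset.Properties
open import Data.Integer using (+_)
open import Data.List using (List; []; _∷_; _++_; [_]; map; concatMap; filter; length; allFin; tabulate; head; drop)
import Data.List.Membership.Propositional as List
import Data.List.Membership.Propositional.Properties as ∈ₚ
import Data.List.Properties as Listₚ
open import Data.List.Relation.Unary.All as All using (All; []; _∷_)
open import Data.List.Relation.Unary.AllPairs using ([]; _∷_)
open import Data.List.Relation.Unary.Any using (here; there)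
open import Data.List.Relation.Unary.Unique.Propositional using (Unique)
import Data.List.Relation.Unary.Unique.Propositional.Properties as Uniqueₚ
open import Data.Maybe using (just)
open import Data.Nat as ℕ using (ℕ; zero; suc; _+_; _*_; _∸_; _≤_; _<_; _<ᵇ_; _≤?_; _≟_; z≤n; s≤s)
open import Data.Nat.ListAction using (sum)
import Data.Nat.Properties as ℕₚ
open import Data.Nat.Solver using () renaming (module +-*-Solver to ℕ-Solver)
open import Data.Product using (Σ; ∃-syntax; _×_; _,_; proj₁; proj₂; swap)
open import Data.Product.Properties using (,-injectiveʳ)
open import Data.Rational as ℚ using (ℚ; 0ℚ)
import Data.Rational.Properties as ℚₚ
open import Data.Rational.Solver using () renaming (module +-*-Solver to ℚ-Solver)
open import Data.Sum using (_⊎_; inj₁; inj₂)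
open import Data.Vec as Vec using ([]; _∷_; there)
open import Data.Vec.Properties using (lookup∘tabulate; []=⇒lookup; lookup⇒[]=)
open import Function using (_∘_; id; _⇔_; mk⇔; Equivalence)
open import Function.Properties.Equivalence using () renaming (trans to ⇔-trans)
open import Relation.Binary using (tri<; tri≈; tri>)
open import Relation.Binary.Construct.Closure.ReflexiveTransitive as Star using (Star; _◅_)
open import Relation.Binary.PropositionalEquality using (_≡_; _≢_; refl; sym; trans; cong; cong₂; subst; ≢-sym)
open import Relation.Nullary using (¬_; yes; no; contradiction; does)
open import Relation.Nullary.Decidable using (dec-true; dec-false; _×-dec_; _→-dec_; ¬?)

-- Real weights

∣p-q∣<r⇒p<q+r : ∀ {p q r} → ℚ.∣ p ℚ.- q ∣ ℚ.< r → p ℚ.< q ℚ.+ r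
∣p-q∣<r⇒p<q+r {p} {q} {r} h = begin-strict
  p                    ≡⟨ solve 2 (λ p q → p := q :+ (p :- q)) refl p q ⟩
  q ℚ.+ (p ℚ.- q)      ≤⟨ ℚₚ.+-monoʳ-≤ q p≤∣p∣ ⟩
  q ℚ.+ ℚ.∣ p ℚ.- q ∣  <⟨ ℚₚ.+-monoʳ-< q h ⟩
  q ℚ.+ r              ∎
  where
  open ℚₚ.≤-Reasoning
  open ℚ-Solver
  p≤∣p∣ : ∀ {p} → p ℚ.≤ ℚ.∣ p ∣
  p≤∣p∣ {p} with ℚₚ.≤-total 0ℚ p
  ... | inj₁ 0≤p = ℚₚ.≤-reflexive (sym (ℚₚ.0≤p⇒∣p∣≡p 0≤p))
  ... | inj₂ p≤0 = ℚₚ.≤-trans p≤0 (ℚₚ.0≤∣p∣ p)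

-- Comparing a and t at one sufficiently late index decides, up to ε, between
-- a ≤ t and b ≤ c + d - t ≤ t; only the first alternative is compatible with b ≰ t.
exchange : ∀ a b c d t → (∀ k → seq a k ℚ.+ seq b k ≡ seq c k ℚ.+ seq d k) →
  c ≤ᴿ t → d ≤ᴿ t → ¬ b ≤ᴿ t → a ≤ᴿ t
exchange a b c d t a+b≡c+d c≤t d≤t b≰t ε 0<ε = N , bound
  where
  δ : ℚ
  -- When the test in `bound` succeeds, six of these add up: one for moving `a` to index `N`, four
  -- from the test, one for moving `t` back.
  δ = (+ 1 ℚ./ 6) ℚ.* ε
  0<δ : 0ℚ ℚ.< δ
  0<δ = subst (ℚ._< δ) (ℚₚ.*-zeroʳ (+ 1 ℚ./ 6)) (ℚₚ.*-monoʳ-<-pos (+ 1 ℚ./ 6) 0<ε)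
  open Σ (c≤t δ 0<δ) renaming (proj₁ to N₁; proj₂ to c≤)
  open Σ (d≤t δ 0<δ) renaming (proj₁ to N₂; proj₂ to d≤)
  open Σ (cauchy a δ 0<δ) renaming (proj₁ to N₃; proj₂ to a≈)
  open Σ (cauchy t δ 0<δ) renaming (proj₁ to N₄; proj₂ to t≈)
  open ℚₚ.≤-Reasoning
  open ℚ-Solver
  sixth : ∀ {n} → Polynomial n → Polynomial n
  sixth x = con (+ 1 ℚ./ 6) :* x
  N = (N₁ ℕ.⊔ N₂) ℕ.⊔ (N₃ ℕ.⊔ N₄)
  N≥₁ : ∀ {n} → N ℕ.≤ n → N₁ ℕ.≤ n
  N≥₁ h = ℕₚ.m⊔n≤o⇒m≤o N₁ N₂ (ℕₚ.m⊔n≤o⇒m≤o _ _ h)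
  N≥₂ : ∀ {n} → N ℕ.≤ n → N₂ ℕ.≤ n
  N≥₂ h = ℕₚ.m⊔n≤o⇒n≤o N₁ N₂ (ℕₚ.m⊔n≤o⇒m≤o _ _ h)
  N≥₃ : ∀ {n} → N ℕ.≤ n → N₃ ℕ.≤ n
  N≥₃ h = ℕₚ.m⊔n≤o⇒m≤o N₃ N₄ (ℕₚ.m⊔n≤o⇒n≤o (N₁ ℕ.⊔ N₂) _ h)
  N≥₄ : ∀ {n} → N ℕ.≤ n → N₄ ℕ.≤ n
  N≥₄ h = ℕₚ.m⊔n≤o⇒n≤o N₃ N₄ (ℕₚ.m⊔n≤o⇒n≤o (N₁ ℕ.⊔ N₂) _ h)

  near : ∀ x M → (∀ m n → M ℕ.≤ m → M ℕ.≤ n → ℚ.∣ seq x m ℚ.- seq x n ∣ ℚ.< δ) →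
    ∀ {m n} → M ℕ.≤ m → M ℕ.≤ n → seq x m ℚ.≤ seq x n ℚ.+ δ
  near x M h p q = ℚₚ.<⇒≤ (∣p-q∣<r⇒p<q+r (h _ _ p q))

  bound : ∀ n → N ℕ.≤ n → seq a n ℚ.≤ seq t n ℚ.+ ε
  bound n N≤n with (seq a N ℚₚ.≤? seq t N ℚ.+ (+ 4 ℚ./ 1) ℚ.* δ)
  ... | yes aN≤tN+4δ = begin
    seq a n
      ≤⟨ near a N₃ a≈ (N≥₃ N≤n) (N≥₃ ℕₚ.≤-refl) ⟩
    seq a N ℚ.+ δ
      ≤⟨ ℚₚ.+-monoˡ-≤ δ aN≤tN+4δ ⟩
    seq t N ℚ.+ (+ 4 ℚ./ 1) ℚ.* δ ℚ.+ δ
      ≤⟨ ℚₚ.+-monoˡ-≤ δ (ℚₚ.+-monoˡ-≤ _ (near t N₄ t≈ (N≥₄ ℕₚ.≤-refl) (N≥₄ N≤n))) ⟩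
    seq t n ℚ.+ δ ℚ.+ (+ 4 ℚ./ 1) ℚ.* δ ℚ.+ δ
      ≡⟨ solve 2 (λ t e → t :+ sixth e :+ con (+ 4 ℚ./ 1) :* sixth e :+ sixth e := t :+ e)
           refl (seq t n) ε ⟩
    seq t n ℚ.+ ε ∎
  ... | no aN≰tN+4δ = contradiction b≤t b≰t
    where
    b≤t : b ≤ᴿ t
    -- The four `δ` of the failed test pay for moving `t` and `a` between `N` and `k` and for the
    -- slack in `c` and `d`. Hence `b` is at most `t` at `k` with no error left, and any `η` will
    -- do.
    b≤t η 0<η = N , λ k N≤k → begin
      seq b k
        ≡⟨ solve 2 (λ a b → b := (a :+ b) :- a) refl (seq a k) (seq b k) ⟩
      (seq a k ℚ.+ seq b k) ℚ.- seq a k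
        ≡⟨ cong (ℚ._- seq a k) (a+b≡c+d k) ⟩
      (seq c k ℚ.+ seq d k) ℚ.- seq a k
        ≤⟨ ℚₚ.+-mono-≤ (ℚₚ.+-mono-≤ (c≤ k (N≥₁ N≤k)) (d≤ k (N≥₂ N≤k)))
             (ℚₚ.neg-antimono-≤ (begin
               seq t k ℚ.+ (+ 2 ℚ./ 1) ℚ.* δ
                 ≤⟨ ℚₚ.+-monoˡ-≤ _ (near t N₄ t≈ (N≥₄ N≤k) (N≥₄ ℕₚ.≤-refl)) ⟩
               seq t N ℚ.+ δ ℚ.+ (+ 2 ℚ./ 1) ℚ.* δ
                 ≡⟨ solve 2 (λ t e → t :+ e :+ con (+ 2 ℚ./ 1) :* e := t :+ con (+ 4 ℚ./ 1) :* e :- e)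
                      refl (seq t N) δ ⟩
               seq t N ℚ.+ (+ 4 ℚ./ 1) ℚ.* δ ℚ.- δ
                 ≤⟨ ℚₚ.+-monoˡ-≤ (ℚ.- δ) (ℚₚ.<⇒≤ (ℚₚ.≰⇒> aN≰tN+4δ)) ⟩
               seq a N ℚ.- δ
                 ≤⟨ ℚₚ.+-monoˡ-≤ (ℚ.- δ) (near a N₃ a≈ (N≥₃ ℕₚ.≤-refl) (N≥₃ N≤k)) ⟩
               seq a k ℚ.+ δ ℚ.- δ
                 ≡⟨ solve 2 (λ a e → a :+ e :- e := a) refl (seq a k) δ ⟩
               seq a k ∎)) ⟩
      (seq t k ℚ.+ δ) ℚ.+ (seq t k ℚ.+ δ) ℚ.- (seq t k ℚ.+ (+ 2 ℚ./ 1) ℚ.* δ)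
        ≡⟨ solve 2 (λ t e → (t :+ e) :+ (t :+ e) :- (t :+ con (+ 2 ℚ./ 1) :* e) := t :+ con 0ℚ)
             refl (seq t k) δ ⟩
      seq t k ℚ.+ 0ℚ
        ≤⟨ ℚₚ.+-monoʳ-≤ (seq t k) (ℚₚ.<⇒≤ 0<η) ⟩
      seq t k ℚ.+ η ∎

sumOver-⊥ : ∀ {n} (w : Fin n → ℝ) k → seq (sumOver ⊥ w) k ≡ 0ℚ
sumOver-⊥ {ℕ.zero}  w k = refl
sumOver-⊥ {ℕ.suc n} w k = sumOver-⊥ (w ∘ suc) k

sumOver-⁅⁆ : ∀ {n} (w : Fin n → ℝ) u k → seq (sumOver ⁅ u ⁆ w) k ≡ seq (w u) k
sumOver-⁅⁆ w zero    k = trans (cong (seq (w zero) k ℚ.+_) (sumOver-⊥ (w ∘ suc) k)) (ℚₚ.+-identityʳ _)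
sumOver-⁅⁆ w (suc u) k = sumOver-⁅⁆ (w ∘ suc) u k

sumOver-pair : ∀ {n} (w : Fin n → ℝ) {u v} → u ≢ v → ∀ k →
  seq (sumOver (⁅ u ⁆ ∪ ⁅ v ⁆) w) k ≡ seq (w u) k ℚ.+ seq (w v) k
sumOver-pair w {zero}  {zero}  u≢v k = contradiction refl u≢v
sumOver-pair w {zero}  {suc v} u≢v k rewrite ∪-identityˡ ⁅ v ⁆ =
  cong (seq (w zero) k ℚ.+_) (sumOver-⁅⁆ (w ∘ suc) v k)
sumOver-pair w {suc u} {zero}  u≢v k rewrite ∪-identityʳ ⁅ u ⁆ =
  trans (cong (seq (w zero) k ℚ.+_) (sumOver-⁅⁆ (w ∘ suc) u k)) (ℚₚ.+-comm (seq (w zero) k) (seq (w (suc u)) k))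
sumOver-pair w {suc u} {suc v} u≢v k = sumOver-pair (w ∘ suc) (u≢v ∘ cong suc) k

-- The machine

-- Registers: 0 holds the number of vertices left, 1 holds l minus the number of
-- leaves found so far, 2 holds the constant 1.  After the test n ≤ l, the three
-- blocks at 6, 9 and 17 read a neighbour list of which zero, one, at least two
-- entries have been seen.
program : Program
program =
  read 0 ∷ read 1 ∷ const 2 1 ∷ sub 3 0 1 ∷ jpos 6 3 ∷ accept ∷
  read 3 ∷ jpos 9 3 ∷ jpos 12 2 ∷
  read 3 ∷ jpos 17 3 ∷ sub 1 1 2 ∷
  sub 0 0 2 ∷ jpos 6 0 ∷ sub 1 1 2 ∷ jpos 5 1 ∷ reject ∷
  read 3 ∷ jpos 17 3 ∷ jpos 12 2 ∷ []

yields-mono : ∀ {P is b k k′} → k ≤ k′ → P on is Yields b Within k → P on is Yields b Within k′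
yields-mono {P} k≤k′ = go k≤k′
  where
  go : ∀ {k k′ c b} → k ≤ k′ → run P k c ≡ just b → run P k′ c ≡ just b
  go {suc k} {suc k′} {c} (s≤s k≤k′) eq with head (drop (Config.pc c) P)
  ... | just i with step i c
  ...   | inj₁ c′ = go k≤k′ eq
  ...   | inj₂ _  = eq

-- The loop invariant. Register 3 is left free because every jump on it directly follows a write to
-- it.
Registers : ℕ → ℕ → (ℕ → ℕ) → Set
Registers r l X = X 0 ≡ r × X 1 ≡ l × X 2 ≡ 1

𝟙-singleton : ∀ {B : Set} → List B → ℕ
𝟙-singleton (_ ∷ []) = 1
𝟙-singleton _        = 0

module _ {A B : Set} (nbrs : A → List B) where

  #leaves : List A → ℕ
  #leaves = sum ∘ map (𝟙-singleton ∘ nbrs)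

  -- The exact number of steps from instruction 6 on: two per entry (read, jump), three for the
  -- terminator in whichever block meets it, two for the vertex counter, and three for the verdict.
  time : List A → ℕ
  time []       = 3
  time (u ∷ us) = 5 + (length (nbrs u) * 2 + time us)

module _ {A B : Set} (nbrs : A → List B) (key : B → ℕ) where

  input : List A → List ℕ
  input = concatMap (λ u → map (suc ∘ key) (nbrs u) ++ [ 0 ])

  private
    -- Here `l` is the original bound minus the number of leaves, so `l ∸ 1` is positive exactly
    -- when the bound exceeds that number by at least two.
    test : ∀ X {l is} → Registers 0 l X →
      run program 3 ⟨ 14 , X , is ⟩ ≡ just (0 <ᵇ l ∸ 1)
    test X (_ , refl , X2) rewrite X2 with X 1 ∸ 1
    ... | zero  = refl
    ... | suc _ = refl

    -- Continuation form: the run from instruction 12 is assumed for all register contents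
    -- satisfying the invariant, so the contents reached need not be named.
    skip-rest : ∀ vs {r l k is b} →
      (∀ X → Registers r l X → run program k ⟨ 12 , X , is ⟩ ≡ just b) →
      ∀ X → Registers r l X →
      run program (length vs * 2 + 3 + k) ⟨ 17 , X , map (suc ∘ key) vs ++ 0 ∷ is ⟩ ≡ just b
    skip-rest []       next X (X0 , X1 , X2) rewrite X2 = next (X [ 3 ≔ 0 ]) (X0 , X1 , X2)
    skip-rest (v ∷ vs) next X inv = skip-rest vs next (X [ 3 ≔ suc (key v) ]) inv

    read-list : ∀ vs {r l k is b} →
      (∀ X → Registers r (l ∸ 𝟙-singleton vs) X → run program k ⟨ 12 , X , is ⟩ ≡ just b) →
      ∀ X → Registers r l X →
      run program (length vs * 2 + 3 + k) ⟨ 6 , X , map (suc ∘ key) vs ++ 0 ∷ is ⟩ ≡ just b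
    read-list []           next X (X0 , X1 , X2) rewrite X2 = next (X [ 3 ≔ 0 ]) (X0 , X1 , X2)
    -- Only the middle block falls through to instruction 11, which charges one leaf to register 1.
    read-list (v ∷ [])     next X (X0 , X1 , X2) =
      next (X [ 3 ≔ suc (key v) ] [ 3 ≔ 0 ] [ 1 ≔ X 1 ∸ X 2 ]) (X0 , cong₂ _∸_ X1 X2 , X2)
    read-list (v ∷ w ∷ vs) next X inv =
      skip-rest vs next (X [ 3 ≔ suc (key v) ] [ 3 ≔ suc (key w) ]) inv

    regroup : ∀ d t → 5 + (d + t) ≡ d + 3 + (2 + t)
    regroup = solve 2 (λ d t → con 5 :+ (d :+ t) := d :+ con 3 :+ (con 2 :+ t)) refl
      where open ℕ-Solver

  scan : ∀ u us {l} X → Registers (suc (length us)) l X →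
    run program (time nbrs (u ∷ us)) ⟨ 6 , X , input (u ∷ us) ⟩ ≡ just (0 <ᵇ l ∸ #leaves nbrs (u ∷ us) ∸ 1)
  scan u us {l} X inv
    rewrite Listₚ.++-assoc (map (suc ∘ key) (nbrs u)) [ 0 ] (input us)
          -- Truncated subtraction leaf by leaf agrees with subtracting the total at once.
          | sym (ℕₚ.∸-+-assoc l (𝟙-singleton (nbrs u)) (#leaves nbrs us)) =
    subst
      (λ k → run program k ⟨ 6 , X , map (suc ∘ key) (nbrs u) ++ 0 ∷ input us ⟩
        ≡ just (0 <ᵇ l ∸ 𝟙-singleton (nbrs u) ∸ #leaves nbrs us ∸ 1))
      (sym (regroup (length (nbrs u) * 2) (time nbrs us)))
      (read-list (nbrs u) (continue us) X inv)
    where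
    continue : ∀ us {l} X → Registers (suc (length us)) l X →
      run program (2 + time nbrs us) ⟨ 12 , X , input us ⟩ ≡ just (0 <ᵇ l ∸ #leaves nbrs us ∸ 1)
    continue []       X (X0 , X1 , X2) rewrite X0 | X2 = test (X [ 0 ≔ 0 ]) (refl , X1 , X2)
    continue (u ∷ us) X (X0 , X1 , X2) rewrite X0 | X2 =
      scan u us (X [ 0 ≔ suc (length us) ]) (refl , X1 , X2)

  decides : ∀ us l → ∃[ b ]
    (program on (length us ∷ l ∷ input us) Yields b Within (5 + time nbrs us) ×
     (b ≡ true ⇔ (length us ≤ l ⊎ 2 + #leaves nbrs us ≤ l)))
  decides us l with length us ≤? l
  decides us       l | yes n≤l = true , accepts us n≤l , mk⇔ (λ _ → inj₁ n≤l) (λ _ → refl)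
    where
    accepts : ∀ us → length us ≤ l →
      program on (length us ∷ l ∷ input us) Yields true Within (5 + time nbrs us)
    -- Splitting on `us` exposes a successor in `time`, which pays for the `accept` step.
    accepts []       n≤l rewrite ℕₚ.m≤n⇒m∸n≡0 n≤l = refl
    accepts (u ∷ us) n≤l rewrite ℕₚ.m≤n⇒m∸n≡0 n≤l = refl
  -- The loop tests its counter only after reading a list, so it must be entered with at least one
  -- vertex left.
  decides []       l | no  n≰l = contradiction z≤n n≰l
  decides (u ∷ us) l | no  n≰l = _ , scans , mk⇔
      (λ b≡true → inj₂ (ℕₚ.m∸n≢0⇒n<m (ℕₚ.>⇒≢ (subst (0 <_) ∸-≡ (ℕₚ.<ᵇ⇒< 0 _ (T-≡ .Equivalence.from b≡true))))))
      λ where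
        (inj₁ n≤l)   → contradiction n≤l n≰l
        (inj₂ 2+m≤l) → T-≡ .Equivalence.to (ℕₚ.<⇒<ᵇ (subst (0 <_) (sym ∸-≡) (ℕₚ.m<n⇒0<n∸m 2+m≤l)))
    where
    ∸-≡ : l ∸ #leaves nbrs (u ∷ us) ∸ 1 ≡ l ∸ suc (#leaves nbrs (u ∷ us))
    ∸-≡ = trans (ℕₚ.∸-+-assoc l (#leaves nbrs (u ∷ us)) 1) (cong (l ∸_) (ℕₚ.+-comm _ 1))
    scans : program on (length (u ∷ us) ∷ l ∷ input (u ∷ us))
      Yields (0 <ᵇ l ∸ #leaves nbrs (u ∷ us) ∸ 1) Within (5 + time nbrs (u ∷ us))
    scans with length (u ∷ us) ∸ l in eq
    ... | zero  = contradiction (ℕₚ.m∸n≡0⇒m≤n eq) n≰l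
    ... | suc _ = scan u us _ (refl , refl , refl)

-- Running time

unique⊆⇒length≤ : ∀ {A : Set} {xs ys : List A} → Unique xs →
  (∀ {x} → x List.∈ xs → x List.∈ ys) → length xs ≤ length ys
unique⊆⇒length≤ {xs = []}     _            _     = z≤n
unique⊆⇒length≤ {xs = x ∷ xs} (x∉xs ∷ xs!) xs⊆ys with ∈ₚ.∈-∃++ (xs⊆ys (here refl))
... | as , bs , refl =
  subst (suc (length xs) ≤_) (sym (Listₚ.length-++-sucʳ as x bs))
    (s≤s (unique⊆⇒length≤ xs! λ z∈xs → avoid (All.lookup x∉xs z∈xs) (xs⊆ys (there z∈xs))))
  where
  avoid : ∀ {z} → x ≢ z → z List.∈ as ++ x ∷ bs → z List.∈ as ++ bs
  avoid x≢z z∈ with ∈ₚ.∈-++⁻ as z∈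
  ... | inj₁ z∈as         = ∈ₚ.∈-++⁺ˡ z∈as
  ... | inj₂ (here refl)  = contradiction refl x≢z
  ... | inj₂ (there z∈bs) = ∈ₚ.∈-++⁺ʳ as z∈bs

module _ {A B : Set} (nbrs : A → List B) where

  -- The length is the sum of the degrees; tagging each entry with its owner keeps entries of
  -- different lists apart.
  incidences : List A → List (A × B)
  incidences = concatMap (λ u → map (u ,_) (nbrs u))

  ∈-incidences⁻ : ∀ us {u v} → (u , v) List.∈ incidences us → u List.∈ us × v List.∈ nbrs u
  ∈-incidences⁻ (w ∷ us) uv∈ with ∈ₚ.∈-++⁻ (map (w ,_) (nbrs w)) uv∈
  ... | inj₁ uv∈w with _ , v∈ , refl ← ∈ₚ.∈-map⁻ (w ,_) uv∈w = here refl , v∈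
  ... | inj₂ uv∈us with u∈ , v∈ ← ∈-incidences⁻ us uv∈us = there u∈ , v∈

  incidences-unique : (∀ u → Unique (nbrs u)) → ∀ {us} → Unique us → Unique (incidences us)
  incidences-unique nbrs! []                    = []
  incidences-unique nbrs! {u ∷ us} (u∉us ∷ us!) =
    Uniqueₚ.++⁺ (Uniqueₚ.map⁺ ,-injectiveʳ (nbrs! u)) (incidences-unique nbrs! us!)
      λ (p∈u , p∈us) → disjoint p∈u p∈us
    where
    disjoint : ∀ {p} → p List.∈ map (u ,_) (nbrs u) → ¬ p List.∈ incidences us
    disjoint p∈u p∈us with _ , _ , refl ← ∈ₚ.∈-map⁻ (u ,_) p∈u =
      All.lookup u∉us (proj₁ (∈-incidences⁻ us p∈us)) refl

  time-≡ : ∀ us → time nbrs us ≡ 3 + (5 * length us + length (incidences us) * 2)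
  time-≡ []       = refl
  time-≡ (u ∷ us)
    rewrite time-≡ us | Listₚ.length-++ (map (u ,_) (nbrs u)) {incidences us}
          | Listₚ.length-map (u ,_) (nbrs u) =
    solve 3 (λ d n e → con 5 :+ (d :* con 2 :+ (con 3 :+ (con 5 :* n :+ e :* con 2))) :=
        con 3 :+ (con 5 :* (con 1 :+ n) :+ (d :+ e) :* con 2))
      refl (length (nbrs u)) (length us) (length (incidences us))
    where open ℕ-Solver

-- Counting leaves and bounding the time by the number of vertices and edges

leaves : ∀ {n} {B : Set} → (Fin n → List B) → Subset n
leaves nbrs = Vec.tabulate λ u → does (length (nbrs u) ≟ 1)

#leaves-≡ : ∀ {n} {B : Set} (nbrs : Fin n → List B) → #leaves nbrs (allFin n) ≡ ∣ leaves nbrs ∣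
#leaves-≡ nbrs = trans (cong sum (Listₚ.map-tabulate id (𝟙-singleton ∘ nbrs))) (count nbrs)
  where
  count : ∀ {n} {B : Set} (nbrs : Fin n → List B) → sum (tabulate (𝟙-singleton ∘ nbrs)) ≡ ∣ leaves nbrs ∣
  count {zero}  nbrs = refl
  count {suc n} nbrs with nbrs zero
  ... | []        = count (nbrs ∘ suc)
  ... | _ ∷ []    = cong suc (count (nbrs ∘ suc))
  ... | _ ∷ _ ∷ _ = count (nbrs ∘ suc)

module _ {n} {G : Graph n} (A : AdjacencyLists G) where
  open Graph G
  open AdjacencyLists A

  -- Each incidence is an edge, stored with its smaller end first, or the reversal of one, and no
  -- incidence is repeated.
  handshake : length (incidences nbrs (allFin n)) ≤ ∣E∣ G + ∣E∣ G
  handshake = subst (length (incidences nbrs (allFin n)) ≤_)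
    (trans (Listₚ.length-++ (edges G)) (cong (∣E∣ G ℕ.+_) (Listₚ.length-map swap (edges G))))
    (unique⊆⇒length≤ (incidences-unique nbrs unique (Uniqueₚ.allFin⁺ n)) both-ways)
    where
    edge : ∀ {u v} → u Fin.< v → u ~ v → (u , v) List.∈ edges G
    edge u<v u~v = ∈ₚ.∈-filter⁺ _
      (∈ₚ.∈-cartesianProduct⁺ (∈ₚ.∈-allFin _) (∈ₚ.∈-allFin _)) (u<v , u~v)
    both-ways : ∀ {p} → p List.∈ incidences nbrs (allFin n) → p List.∈ edges G ++ map swap (edges G)
    both-ways {u , v} p∈ with Equivalence.to nbrs-spec (proj₂ (∈-incidences⁻ nbrs (allFin n) p∈)) | Finₚ.<-cmp u v
    ... | u~v | tri< u<v _ _  = ∈ₚ.∈-++⁺ˡ (edge u<v u~v)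
    ... | u~v | tri≈ _ u≡v _  = contradiction u~v (~-irrefl u≡v)
    ... | u~v | tri> _ _ v<u  = ∈ₚ.∈-++⁺ʳ (edges G) (∈ₚ.∈-map⁺ swap (edge v<u (~-sym u~v)))

  decides-in-linear-time : Fin n → ∀ l → ∃[ b ]
    (program on encode A l Yields b Within (13 * (n + ∣E∣ G)) ×
     (b ≡ true ⇔ (n ≤ l ⊎ 2 + ∣ leaves nbrs ∣ ≤ l)))
  decides-in-linear-time v l with decides nbrs toℕ (allFin n) l
  ... | b , halts , b≡true⇔
    rewrite time-≡ nbrs (allFin n) | #leaves-≡ nbrs | Listₚ.length-tabulate {n = n} id =
    b , yields-mono {P = program} steps≤ halts , b≡true⇔
    where
    open ℕₚ.≤-Reasoning
    open ℕ-Solver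
    2∣E∣ = ∣E∣ G + ∣E∣ G
    steps≤ : 5 + (3 + (5 * n + length (incidences nbrs (allFin n)) * 2)) ≤ 13 * (n + ∣E∣ G)
    -- The vertex `v` gives `1 ≤ n`, so the constant 8 is at most `8 * n`; the edge term, four times
    -- the number of edges, is padded to thirteen.
    steps≤ = begin
      8 + (5 * n + length (incidences nbrs (allFin n)) * 2)
        ≤⟨ ℕₚ.+-mono-≤ (ℕₚ.*-monoʳ-≤ 8 (ℕₚ.≤-trans (s≤s z≤n) (Finₚ.toℕ<n v)))
             (ℕₚ.+-monoʳ-≤ (5 * n) (ℕₚ.*-monoˡ-≤ 2 handshake)) ⟩
      8 * n + (5 * n + 2∣E∣ * 2)
        ≤⟨ ℕₚ.m≤m+n _ (9 * ∣E∣ G) ⟩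
      8 * n + (5 * n + 2∣E∣ * 2) + 9 * ∣E∣ G
        ≡⟨ solve 2 (λ n e → con 8 :* n :+ (con 5 :* n :+ (e :+ e) :* con 2) :+ con 9 :* e
             := con 13 :* (n :+ e)) refl n (∣E∣ G) ⟩
      13 * (n + ∣E∣ G) ∎

-- Threshold graphs

∈-leaves⁺ : ∀ {n} {B : Set} (nbrs : Fin n → List B) {u} → length (nbrs u) ≡ 1 → u ∈ leaves nbrs
∈-leaves⁺ nbrs {u} eq = lookup⇒[]= u _ (trans (lookup∘tabulate _ u) (dec-true (length (nbrs u) ≟ 1) eq))

∈-leaves⁻ : ∀ {n} {B : Set} (nbrs : Fin n → List B) {u} → u ∈ leaves nbrs → length (nbrs u) ≡ 1
∈-leaves⁻ nbrs {u} u∈ with length (nbrs u) ≟ 1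
... | yes eq = eq
... | no ≢1 = contradiction
  (trans (sym (trans (lookup∘tabulate _ u) (dec-false (length (nbrs u) ≟ 1) ≢1))) ([]=⇒lookup u∈)) λ ()

∣p∪⁅x⁆∣≤1+∣p∣ : ∀ {n} (p : Subset n) x → ∣ p ∪ ⁅ x ⁆ ∣ ≤ suc ∣ p ∣
∣p∪⁅x⁆∣≤1+∣p∣ (inside  ∷ p) zero    rewrite ∪-identityʳ p = ℕₚ.n≤1+n _
∣p∪⁅x⁆∣≤1+∣p∣ (outside ∷ p) zero    rewrite ∪-identityʳ p = ℕₚ.≤-refl
∣p∪⁅x⁆∣≤1+∣p∣ (inside  ∷ p) (suc x) = ℕ.s≤s (∣p∪⁅x⁆∣≤1+∣p∣ p x)
∣p∪⁅x⁆∣≤1+∣p∣ (outside ∷ p) (suc x) = ∣p∪⁅x⁆∣≤1+∣p∣ p x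

x∈p-y⇒x≢y : ∀ {n} (p : Subset n) {x y} → x ∈ p - y → x ≢ y
x∈p-y⇒x≢y (_ ∷ p) {zero}  {zero}  ()
x∈p-y⇒x≢y (_ ∷ p) {zero}  {suc y} _ ()
x∈p-y⇒x≢y (_ ∷ p) {suc x} {zero}  _ ()
x∈p-y⇒x≢y (_ ∷ p) {suc x} {suc y} (there x∈) refl = x∈p-y⇒x≢y p x∈ refl

module _ {n : ℕ} (G : Graph n) where
  open Graph G

  ~⇒≢ : ∀ {u v} → u ~ v → u ≢ v
  ~⇒≢ u~v u≡v = ~-irrefl u≡v u~v

  pair-independent : ∀ {u v} → ¬ u ~ v → Independent G (⁅ u ⁆ ∪ ⁅ v ⁆)
  pair-independent {u} {v} u≁v x∈ y∈ x~y
    with x∈p∪q⁻ ⁅ u ⁆ ⁅ v ⁆ x∈ | x∈p∪q⁻ ⁅ u ⁆ ⁅ v ⁆ y∈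
  ... | inj₁ x∈u | inj₁ y∈u rewrite x∈⁅y⁆⇒x≡y u x∈u | x∈⁅y⁆⇒x≡y u y∈u = ~-irrefl refl x~y
  ... | inj₁ x∈u | inj₂ y∈v rewrite x∈⁅y⁆⇒x≡y u x∈u | x∈⁅y⁆⇒x≡y v y∈v = u≁v x~y
  ... | inj₂ x∈v | inj₁ y∈u rewrite x∈⁅y⁆⇒x≡y v x∈v | x∈⁅y⁆⇒x≡y u y∈u = u≁v (~-sym x~y)
  ... | inj₂ x∈v | inj₂ y∈v rewrite x∈⁅y⁆⇒x≡y v x∈v | x∈⁅y⁆⇒x≡y v y∈v = ~-irrefl refl x~y

  -- Otherwise the pairs `ac` and `bd` are independent and weigh at most `t`, while the edges `ab`
  -- and `cd` do not; but both pairings have the same total weight. This excludes induced 2K2, P4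
  -- and C4 at once.
  no-alternating-4-cycle : IsThreshold G → ∀ {a b c d} → a ≢ c → b ≢ d →
    a ~ b → c ~ d → ¬ a ~ c → b ~ d
  no-alternating-4-cycle (t , w , thr) {a} {b} {c} {d} a≢c b≢d a~b c~d a≁c with b ~? d
  ... | yes b~d = b~d
  ... | no  b≁d = contradiction
      (exchange (s a b) (s c d) (s a c) (s b d) t sums (light a≁c) (light b≁d) (heavy c~d)) (heavy a~b)
    where
    s : Fin n → Fin n → ℝ
    s u v = sumOver (⁅ u ⁆ ∪ ⁅ v ⁆) w
    light : ∀ {u v} → ¬ u ~ v → s u v ≤ᴿ t
    light u≁v = Equivalence.to (thr _) (pair-independent u≁v)
    heavy : ∀ {u v} → u ~ v → ¬ s u v ≤ᴿ t
    heavy {u} {v} u~v h = Equivalence.from (thr _) h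
      (p⊆p∪q ⁅ v ⁆ (x∈⁅x⁆ u)) (q⊆p∪q ⁅ u ⁆ ⁅ v ⁆ (x∈⁅x⁆ v)) u~v
    sums : ∀ k → seq (s a b) k ℚ.+ seq (s c d) k ≡ seq (s a c) k ℚ.+ seq (s b d) k
    sums k rewrite sumOver-pair w (~⇒≢ a~b) k | sumOver-pair w (~⇒≢ c~d) k
                 | sumOver-pair w a≢c k | sumOver-pair w b≢d k =
      solve 4 (λ a b c d → (a :+ b) :+ (c :+ d) := (a :+ c) :+ (b :+ d)) refl
        (seq (w a) k) (seq (w b) k) (seq (w c) k) (seq (w d) k)
      where
      open ℚ-Solver

  -- The vicinal preorder

  infix 4 _≼_
  -- The open neighbourhood of `v` lies in the closed neighbourhood of `w`. Without exempting
  -- `u = w`, adjacent vertices would never be comparable.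
  _≼_ : Fin n → Fin n → Set
  v ≼ w = ∀ u → u ≢ w → u ~ v → u ~ w

  ≼-refl : ∀ {v} → v ≼ v
  ≼-refl _ _ u~v = u~v

  ≼-trans : ∀ {v w z} → v ≼ w → w ≼ z → v ≼ z
  ≼-trans {v} {w} {z} v≼w w≼z u u≢z u~v with u Finₚ.≟ w | v Finₚ.≟ z
  ... | no u≢w   | _        = w≼z u u≢z (v≼w u u≢w u~v)
  ... | yes refl | yes refl = u~v
  -- Here `u` is `w`. Since `v` is a neighbour of `w`, it is one of `z`; then `z` is a neighbour of
  -- `v`, hence of `w`.
  ... | yes refl | no v≢z   = ~-sym (v≼w z (≢-sym u≢z) (~-sym (w≼z v v≢z (~-sym u~v))))

  -- A witness `u` against `v ≼ w` is adjacent to `v` but not to `w`. For a neighbour `x` of `w`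
  -- other than `v`, the edges `uv` and `wx` then force `v ~ x`.
  ≼-total : IsThreshold G → ∀ v w → v ≼ w ⊎ w ≼ v
  ≼-total thr v w with Finₚ.all? (λ u → ¬? (u Finₚ.≟ w) →-dec (u ~? v →-dec u ~? w))
  ... | yes v≼w = inj₁ v≼w
  ... | no  v⋠w with Finₚ.¬∀⟶∃¬ n _ (λ u → ¬? (u Finₚ.≟ w) →-dec (u ~? v →-dec u ~? w)) v⋠w
  ...   | u , ¬impl = inj₂ w≼v
    where
    u≢w : u ≢ w
    u≢w u≡w = ¬impl λ u≢w → contradiction u≡w u≢w
    u≁w : ¬ u ~ w
    u≁w u~w = ¬impl λ _ _ → u~w
    u~v : u ~ v
    u~v with u ~? v
    ... | yes u~v = u~v
    ... | no  u≁v = ⊥-elim (¬impl λ _ u~v → contradiction u~v u≁v)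
    w≼v : w ≼ v
    w≼v x x≢v x~w = ~-sym (no-alternating-4-cycle thr u≢w (≢-sym x≢v) u~v (~-sym x~w) u≁w)

  ≼-maximum : IsThreshold G → ∀ v vs → ∃[ m ] (m List.∈ v ∷ vs × All (_≼ m) (v ∷ vs))
  ≼-maximum thr v []       = v , here refl , ≼-refl ∷ []
  ≼-maximum thr v (w ∷ vs) with ≼-maximum thr w vs
  ... | m , m∈ , ≼m with ≼-total thr v m
  ...   | inj₁ v≼m = m , there m∈ , v≼m ∷ ≼m
  ...   | inj₂ m≼v = v , here refl , ≼-refl ∷ All.map (λ x≼m → ≼-trans x≼m m≼v) ≼m

  -- Universal vertices and connected dominating sets

  Universal : Fin n → Set
  Universal d = ∀ {u} → u ≢ d → u ~ d

  first-step : ∀ {S : Subset n} {u v} → u ≢ v →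
    Star (λ x y → x ∈ S × y ∈ S × x ~ y) u v → ∃[ x ] (x ∈ S × u ~ x)
  first-step u≢v Star.ε                       = contradiction refl u≢v
  first-step _   ((_ , x∈S , u~x) ◅ _) = _ , x∈S , u~x

  -- A largest vertex `d` of the preorder works: any other `u` has a neighbour `x` by connectedness,
  -- and `x ≼ d` makes `u` adjacent to `d`.
  ∃-universal : Connected G → IsThreshold G → Fin n → ∃[ d ] Universal d
  ∃-universal conn thr v with ≼-maximum thr v (allFin n)
  ... | d , _ , _ ∷ ≼d = d , λ u≢d →
    let x , _ , u~x = first-step u≢d (conn ∈⊤ ∈⊤)
    in All.lookup ≼d (∈ₚ.∈-allFin x) _ u≢d u~x

  universal-CDS : ∀ {d S} → Universal d → d ∈ S → IsCDS G S
  universal-CDS {d} {S} univ d∈S = (λ u∉S → d , d∈S , univ λ { refl → u∉S d∈S }) , connected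
    where
    connected : InducedConnected G S
    connected {u} {v} u∈S v∈S with u Finₚ.≟ d | v Finₚ.≟ d
    ... | yes refl | yes refl = Star.ε
    ... | yes refl | no v≢d   = (u∈S , v∈S , ~-sym (univ v≢d)) ◅ Star.ε
    ... | no u≢d   | yes refl = (u∈S , v∈S , univ u≢d) ◅ Star.ε
    ... | no u≢d   | no v≢d   = (u∈S , d∈S , univ u≢d) ◅ (d∈S , v∈S , ~-sym (univ v≢d)) ◅ Star.ε

  ∃-non-adjacent : ¬ Complete G → ∃[ a ] ∃[ b ] (a ≢ b × ¬ a ~ b)
  ∃-non-adjacent ¬complete with Finₚ.any? (λ a → Finₚ.any? λ b → ¬? (a Finₚ.≟ b) ×-dec ¬? (a ~? b))
  ... | yes ab = ab
  ... | no ∄ab = contradiction complete ¬complete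
    where
    complete : Complete G
    complete u v u≢v with u ~? v
    ... | yes u~v = u~v
    ... | no  u≁v = contradiction (u , v , u≢v , u≁v) ∄ab

  -- The least size of a secure connected dominating set

  module _ (A : AdjacencyLists G) (¬complete : ¬ Complete G)
    {d : Fin n} (univ : Universal d) where
    open AdjacencyLists A

    L : Subset n
    L = leaves nbrs

    leaf-nbr : ∀ {p x} → p ∈ L → p ≢ d → p ~ x → x ≡ d
    leaf-nbr {p} p∈L p≢d p~x with nbrs p | ∈-leaves⁻ nbrs p∈L
      | Equivalence.from (nbrs-spec {p}) p~x | Equivalence.from (nbrs-spec {p}) (univ p≢d)
    ... | _ ∷ [] | refl | here refl | here refl = refl

    -- The list of `u` contains `d` and is not a singleton, so it starts with two entries; these are
    -- distinct, so one of them is not `d`.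
    second-nbr : ∀ {u} → u ∉ L → u ≢ d → ∃[ x ] (x ≢ d × u ~ x)
    second-nbr {u} u∉L u≢d with nbrs u in eq | Equivalence.from (nbrs-spec {u}) (univ u≢d) | unique u
    ... | _ ∷ []    | _ | _ = contradiction (∈-leaves⁺ nbrs (cong length eq)) u∉L
    ... | x ∷ y ∷ _ | _ | (x≢y ∷ _) ∷ _ with x Finₚ.≟ d
    ...   | no x≢d   = x , x≢d , Equivalence.to nbrs-spec (subst (x List.∈_) (sym eq) (here refl))
    ...   | yes refl = y , ≢-sym x≢y , Equivalence.to nbrs-spec (subst (y List.∈_) (sym eq) (there (here refl)))

    ⊤-SCDS : IsSCDS G ⊤
    ⊤-SCDS = universal-CDS univ ∈⊤ , λ u∉⊤ → contradiction ∈⊤ u∉⊤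

    small-SCDS : IsThreshold G → ∃[ S ] (IsSCDS G S × ∣ S ∣ ≤ 2 + ∣ L ∣)
    small-SCDS thr = S , (universal-CDS univ d∈S , secure) , size
      where
      others : ∃[ v ] (v ≢ d)
      others with ∃-non-adjacent ¬complete
      ... | a , b , a≢b , _ with a Finₚ.≟ d
      ...   | no a≢d   = a , a≢d
      ...   | yes refl = b , ≢-sym a≢b
      v₀ = proj₁ others
      -- The head `v₀` makes the list of candidates nonempty, and it too differs from `d`.
      max = ≼-maximum thr v₀ (filter (λ v → ¬? (v Finₚ.≟ d)) (allFin n))
      e = proj₁ max
      e≢d : e ≢ d
      e≢d with proj₁ (proj₂ max)
      ... | here eq  = subst (_≢ d) (sym eq) (proj₂ others)
      ... | there e∈ = proj₂ (∈ₚ.∈-filter⁻ (λ v → ¬? (v Finₚ.≟ d)) {xs = allFin n} e∈)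
      ≼e : ∀ {x} → x ≢ d → x ≼ e
      ≼e {x} x≢d = All.lookup (proj₂ (proj₂ max)) (there (∈ₚ.∈-filter⁺ _ (∈ₚ.∈-allFin x) x≢d))
      S : Subset n
      S = L ∪ ⁅ d ⁆ ∪ ⁅ e ⁆
      d∈S : d ∈ S
      d∈S = q⊆p∪q L _ (p⊆p∪q ⁅ e ⁆ (x∈⁅x⁆ d))
      e∈S : e ∈ S
      e∈S = q⊆p∪q L _ (q⊆p∪q ⁅ d ⁆ _ (x∈⁅x⁆ e))
      secure : ∀ {u} → u ∉ S → ∃[ v ] (v ∈ S × u ~ v × IsCDS G ((S - v) ∪ ⁅ u ⁆))
      secure {u} u∉S with second-nbr (u∉S ∘ p⊆p∪q _) (λ { refl → u∉S d∈S })
      ... | x , x≢d , u~x = e , e∈S , ≼e x≢d u (λ { refl → u∉S e∈S }) u~x ,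
        universal-CDS univ (p⊆p∪q ⁅ u ⁆ (x∈p∧x≢y⇒x∈p-y d∈S (≢-sym e≢d)))
      size : ∣ S ∣ ≤ 2 + ∣ L ∣
      size = subst (λ T → ∣ T ∣ ≤ 2 + ∣ L ∣) (∪-assoc L ⁅ d ⁆ ⁅ e ⁆)
        (ℕₚ.≤-trans (∣p∪⁅x⁆∣≤1+∣p∣ (L ∪ ⁅ d ⁆) e) (ℕ.s≤s (∣p∪⁅x⁆∣≤1+∣p∣ L d)))

    -- `L` survives the removal of `x` and then `y` from `S`, and each removal lowers the
    -- cardinality.
    two-more : ∀ {S x y} → x ∈ S → y ∈ S → y ≢ x → x ∉ L → y ∉ L →
      (∀ {p} → p ∈ L → p ∈ S) → 2 + ∣ L ∣ ≤ ∣ S ∣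
    two-more {S} {x} {y} x∈S y∈S y≢x x∉L y∉L L⊆S =
      ℕₚ.≤-trans (ℕ.s≤s (ℕₚ.≤-trans (ℕ.s≤s (p⊆q⇒∣p∣≤∣q∣ L⊆)) (x∈p⇒∣p-x∣<∣p∣ (x∈p∧x≢y⇒x∈p-y y∈S y≢x))))
        (x∈p⇒∣p-x∣<∣p∣ x∈S)
      where
      L⊆ : ∀ {p} → p ∈ L → p ∈ S - x - y
      L⊆ p∈L = x∈p∧x≢y⇒x∈p-y (x∈p∧x≢y⇒x∈p-y (L⊆S p∈L) λ { refl → x∉L p∈L }) λ { refl → y∉L p∈L }

    -- Neither end of a non-adjacent pair is `d`, so both ends are neighbours of `d`.
    d∉L : d ∉ L
    d∉L d∈L with ∃-non-adjacent ¬complete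
    ... | a , b , a≢b , a≁b = at-most-one (nbrs d) (∈-leaves⁻ nbrs d∈L) (d-nbr a≢d) (d-nbr b≢d)
      where
      a≢d : a ≢ d
      a≢d refl = a≁b (~-sym (univ (≢-sym a≢b)))
      b≢d : b ≢ d
      b≢d refl = a≁b (univ a≢b)
      d-nbr : ∀ {x} → x ≢ d → x List.∈ nbrs d
      d-nbr x≢d = Equivalence.from nbrs-spec (~-sym (univ x≢d))
      at-most-one : ∀ xs → length xs ≡ 1 → a List.∈ xs → ¬ b List.∈ xs
      at-most-one (_ ∷ []) _ (here refl) (here refl) = a≢b refl

    -- If `d` were missing, the leaf `p` would have to lie in `T`, since only `d` can dominate it. A
    -- third vertex `a` is in `T` or dominated by something other than `p`, so `T` has a second
    -- element, and the path to it from `p` starts through `d`.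
    centre∈CDS : ∀ {p T} → p ∈ L → IsCDS G T → d ∈ T
    centre∈CDS {p} {T} p∈L (dom , conn) with d ∈? T
    ... | yes d∈T = d∈T
    ... | no  d∉T = contradiction (via-p p∈T) d∉T
      where
      p≢d : p ≢ d
      p≢d refl = d∉L p∈L
      p∈T : p ∈ T
      p∈T with p ∈? T
      ... | yes p∈T = p∈T
      ... | no  p∉T with dom p∉T
      ...   | x , x∈T , p~x = contradiction (subst (_∈ T) (leaf-nbr p∈L p≢d p~x) x∈T) d∉T
      another : ∃[ a ] (a ≢ d × a ≢ p)
      another with ∃-non-adjacent ¬complete
      ... | a , b , a≢b , a≁b with a Finₚ.≟ p
      ...   | no a≢p   = a , (λ { refl → a≁b (~-sym (univ (≢-sym a≢b))) }) , a≢p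
      ...   | yes refl = b , (λ { refl → a≁b (univ a≢b) }) , ≢-sym a≢b
      a = proj₁ another
      other : ∃[ z ] (z ∈ T × z ≢ p)
      other with a ∈? T
      ... | yes a∈T = a , a∈T , proj₂ (proj₂ another)
      ... | no  a∉T with dom a∉T
      ...   | z , z∈T , a~z = z , z∈T , λ { refl → proj₁ (proj₂ another) (leaf-nbr p∈L p≢d (~-sym a~z)) }
      via-p : p ∈ T → d ∈ T
      via-p p∈T with other
      ... | z , z∈T , z≢p with first-step (≢-sym z≢p) (conn p∈T z∈T)
      ...   | x , x∈T , p~x = subst (_∈ T) (leaf-nbr p∈L p≢d p~x) x∈T

    SCDS-size : ∀ {S} → IsSCDS G S → n ≤ ∣ S ∣ ⊎ 2 + ∣ L ∣ ≤ ∣ S ∣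
    SCDS-size {S} ((dom , conn) , secure) with Finₚ.any? (λ u → ¬? (u ∈? S))
    ... | no ∄u∉S = inj₁ (subst (_≤ ∣ S ∣) (∣⊤∣≡n n) (p⊆q⇒∣p∣≤∣q∣ {p = ⊤} λ {u} _ → all-in u))
      where
      all-in : ∀ u → u ∈ S
      all-in u with u ∈? S
      ... | yes u∈S = u∈S
      ... | no  u∉S = contradiction (u , u∉S) ∄u∉S
    ... | yes (u , u∉S) with secure u∉S | Finₚ.any? (_∈? L)
    ...   | v , v∈S , u~v , cds | yes (p , p∈L) =
      -- The two extra vertices are `d` and the swap partner `v` of `u`: `v` is not `d`, which the
      -- swap must keep, and not a leaf, since its neighbour `u` is not `d`.
      inj₂ (two-more d∈S v∈S v≢d d∉L (λ v∈L → u≢d (leaf-nbr v∈L v≢d (~-sym u~v))) L⊆S)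
      where
      d∈S : d ∈ S
      d∈S = centre∈CDS p∈L (dom , conn)
      u≢d : u ≢ d
      u≢d refl = u∉S d∈S
      swap≢d : ∀ {x y} → x ≢ d → IsCDS G ((S - y) ∪ ⁅ x ⁆) → y ≢ d
      swap≢d {x} {y} x≢d cds refl with x∈p∪q⁻ (S - d) ⁅ x ⁆ (centre∈CDS p∈L cds)
      ... | inj₁ d∈S-d = x∈p-y⇒x≢y S d∈S-d refl
      ... | inj₂ d∈x   = x≢d (sym (x∈⁅y⁆⇒x≡y x d∈x))
      v≢d : v ≢ d
      v≢d = swap≢d u≢d cds
      -- A leaf outside `S` could only be swapped with its sole neighbour `d`, but `d` cannot be
      -- removed.
      L⊆S : ∀ {q} → q ∈ L → q ∈ S
      L⊆S {q} q∈L with q ∈? S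
      ... | yes q∈S = q∈S
      ... | no  q∉S with secure q∉S
      ...   | y , y∈S , q~y , cds′ = contradiction (leaf-nbr q∈L q≢d q~y) (swap≢d q≢d cds′)
        where
        q≢d : q ≢ d
        q≢d refl = d∉L q∈L
    ...   | v , v∈S , u~v , cds | no ∄leaf with Finₚ.any? (λ x → (x ∈? S) ×-dec ¬? (x Finₚ.≟ v))
    ...     | yes (x , x∈S , x≢v) = inj₂ (two-more v∈S x∈S x≢v ∉L ∉L λ p∈L → contradiction (_ , p∈L) ∄leaf)
      where
      ∉L : ∀ {x} → x ∉ L
      ∉L x∈L = ∄leaf (_ , x∈L)
    ...     | no ∄x = contradiction complete ¬complete
      where
      only-v : ∀ {x} → x ∈ S → x ≡ v
      only-v {x} x∈S with x Finₚ.≟ v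
      ... | yes x≡v = x≡v
      ... | no  x≢v = contradiction (x , x∈S , x≢v) ∄x
      ∉S : ∀ {x} → x ≢ v → x ∉ S
      ∉S x≢v x∈S = x≢v (only-v x∈S)
      -- Now `S` consists of `v` alone, so `v` is adjacent to all others. For `y` other than `v`,
      -- swapping in `y` leaves `y` alone as a dominating set, so `y` is adjacent to all others too.
      complete : Complete G
      complete y z y≢z with y Finₚ.≟ v
      ... | yes refl with dom (∉S (≢-sym y≢z))
      ...   | x , x∈S , z~x rewrite only-v x∈S = ~-sym z~x
      complete y z y≢z | no y≢v with secure (∉S y≢v)
      ...   | v′ , v′∈S , _ , (dom′ , _) with dom′ z∉
        where
        z∉ : z ∉ (S - v′) ∪ ⁅ y ⁆
        z∉ z∈ with x∈p∪q⁻ (S - v′) ⁅ y ⁆ z∈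
        ... | inj₁ z∈S-v′ = x∈p-y⇒x≢y S z∈S-v′
                (trans (only-v (p─q⊆p S ⁅ v′ ⁆ z∈S-v′)) (sym (only-v v′∈S)))
        ... | inj₂ z∈y = y≢z (sym (x∈⁅y⁆⇒x≡y y z∈y))
      ...     | x , x∈ , z~x with x∈p∪q⁻ (S - v′) ⁅ y ⁆ x∈
      ...       | inj₁ x∈S-v′ = contradiction
                    (trans (only-v (p─q⊆p S ⁅ v′ ⁆ x∈S-v′)) (sym (only-v v′∈S))) (x∈p-y⇒x≢y S x∈S-v′)
      ...       | inj₂ x∈y = ~-sym (subst (z ~_) (x∈⁅y⁆⇒x≡y y x∈y) z~x)

    SCDS⇔ : IsThreshold G → ∀ l → (n ≤ l ⊎ 2 + ∣ L ∣ ≤ l) ⇔ (∃[ S ] (IsSCDS G S × ∣ S ∣ ≤ l))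
    SCDS⇔ thr l = mk⇔ to from
      where
      to : n ≤ l ⊎ 2 + ∣ L ∣ ≤ l → ∃[ S ] (IsSCDS G S × ∣ S ∣ ≤ l)
      to (inj₁ n≤l) = ⊤ , ⊤-SCDS , subst (_≤ l) (sym (∣⊤∣≡n n)) n≤l
      to (inj₂ m≤l) with small-SCDS thr
      ... | S , scds , size = S , scds , ℕₚ.≤-trans size m≤l
      from : ∃[ S ] (IsSCDS G S × ∣ S ∣ ≤ l) → n ≤ l ⊎ 2 + ∣ L ∣ ≤ l
      from (S , scds , ∣S∣≤l) with SCDS-size scds
      ... | inj₁ n≤ = inj₁ (ℕₚ.≤-trans n≤ ∣S∣≤l)
      ... | inj₂ m≤ = inj₂ (ℕₚ.≤-trans m≤ ∣S∣≤l)

theorem14 : ∃[ P ] ∃[ c ]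
    (∀ (n : ℕ) (G : Graph n) (A : AdjacencyLists G) (l : ℕ) →
    Connected G → ¬ Complete G → IsThreshold G → 1 ≤ l →
    ∃[ b ] ((P on encode A l Yields b Within (c * (n + ∣E∣ G))) ×
    (b ≡ true ⇔ (∃[ S ] (IsSCDS G S × ∣ S ∣ ≤ l)))))
theorem14 = program , 13 , λ n G A l conn ¬complete thr _ →
  -- Non-completeness supplies the vertex from which the search for `d` starts and which makes `n`
  -- positive in the time bound.
  let v , _ = ∃-non-adjacent G ¬complete
      d , univ = ∃-universal G conn thr v
      b , halts , b≡true⇔ = decides-in-linear-time A v l
  in b , halts , ⇔-trans b≡true⇔ (SCDS⇔ G A ¬complete univ thr l)
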